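{- Let $n\geq 2$ and let $S_n=K_{1,n-1}$ be the star on $n$ vertices, with centre vertex $v$ (a vertex adjacent to all others). Let $c_0:V(S_n)\to\mathbb{Z}$ be any initial chip configuration. Let $\ell_M$ be a leaf with the maximum number of chips in $c_0$ among all leaves and $\ell_m$ a leaf with the minimum number of chips in $c_0$ among all leaves, and let $d_0=c_0(\ell_M)-c_0(\ell_m)$. Then the configuration is tight with pre-period length at most \[\left\lceil\frac{\max \{ 0,\ c_0(v) - c_0(\ell_M),\ c_0(\ell_m) - c_0(v) \}}{n}\right\rceil + 2d_0.\]
   Context: Diffusion process: for a finite simple graph $G$ and a chip configuration $c_t:V(G)\to\mathbb{Z}$ (negative values allowed), the next configuration is defined simultaneously for every vertex $u$ by $c_{t+1}(u)=c_t(u)-|\{w\in N(u): c_t(u)>c_t(w)\}|+|\{w\in N(u): c_t(u)<c_t(w)\}|$. Tight means the process is eventually fixed or eventually periodic with period length 2, i.e. $c_{t+2}=c_t$ for some $t$; the pre-period length is then the least $t\geq0$ with $c_{t+p}=c_t$ where $p$ is the minimal period. -}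

module Defs where

open import Data.Fin.Base using (Fin)
import Data.Fin.Properties as Fin
open import Data.Integer.Base as ℤ using (ℤ; +_)
import Data.Integer.Properties as ℤ
open import Data.Nat.Base using (ℕ; _+_; _≤_)
open import Data.Nat.GeneralisedArithmetic using (fold)
open import Data.Product.Base using (_×_; _,_; ∃-syntax)
open import Data.Sum.Base using (_⊎_; inj₁; inj₂; swap)
open import Data.Vec.Base using (allFin; count)
open import Level using (0ℓ)
open import Relation.Binary.Core using (Rel)
open import Relation.Binary.Definitions using (Decidable; Irreflexive; Symmetric)
open import Relation.Binary.PropositionalEquality using (_≡_; _≢_; _≗_; refl)
open import Relation.Nullary.Decidable using (_×-dec_; _⊎-dec_; ¬?)

record SimpleGraph (n : ℕ) : Set₁ where
  field
    Adj         : Rel (Fin n) 0ℓ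
    adj?        : Decidable Adj
    symmetric   : Symmetric Adj
    irreflexive : Irreflexive _≡_ Adj

-- K₁,ₙ₋₁ on the vertex set Fin n; any vertex v may serve as the centre.
star : ∀ {n} → Fin n → SimpleGraph n
star v = record
  { Adj         = λ u w → (u ≡ v × w ≢ v) ⊎ (w ≡ v × u ≢ v)
  ; adj?        = λ u w → ((u Fin.≟ v) ×-dec ¬? (w Fin.≟ v)) ⊎-dec
                          ((w Fin.≟ v) ×-dec ¬? (u Fin.≟ v))
  ; symmetric   = swap
  ; irreflexive = λ { refl (inj₁ (u≡v , u≢v)) → u≢v u≡v
                    ; refl (inj₂ (u≡v , u≢v)) → u≢v u≡v }
  }

Config : ℕ → Set
Config n = Fin n → ℤ

module _ {n : ℕ} (G : SimpleGraph n) where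
  open SimpleGraph G

  poorerNeighbours : Config n → Fin n → ℕ
  poorerNeighbours c u = count (λ w → adj? u w ×-dec (c w ℤ.<? c u)) (allFin n)

  richerNeighbours : Config n → Fin n → ℕ
  richerNeighbours c u = count (λ w → adj? u w ×-dec (c u ℤ.<? c w)) (allFin n)

  step : Config n → Config n
  step c u = c u ℤ.- + poorerNeighbours c u ℤ.+ + richerNeighbours c u

  -- The configuration cₜ, where c = c₀.
  run : Config n → ℕ → Config n
  run c t = fold c step t

-- Configurations are compared pointwise (_≗_), as there is no function
-- extensionality.

Least : (ℕ → Set) → ℕ → Set
Least P m = P m × (∀ k → P k → m ≤ k)

module _ {n : ℕ} (G : SimpleGraph n) (c : Config n) where

  Tight : Set
  Tight = ∃[ t ] run G c (2 + t) ≗ run G c t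

  EventualPeriod : ℕ → Set
  EventualPeriod p = 1 ≤ p × ∃[ t ] run G c (p + t) ≗ run G c t

  PrePeriodLength : ℕ → Set
  PrePeriodLength m =
    ∃[ p ] Least EventualPeriod p × Least (λ t → run G c (p + t) ≗ run G c t) m

module _ {n : ℕ} (v : Fin n) (c : Config n) where

  -- The leaves of star v are the vertices other than v.
  IsMaximumLeaf : Fin n → Set
  IsMaximumLeaf ℓ = ℓ ≢ v × (∀ k → k ≢ v → c k ℤ.≤ c ℓ)

  IsMinimumLeaf : Fin n → Set
  IsMinimumLeaf ℓ = ℓ ≢ v × (∀ k → k ≢ v → c ℓ ℤ.≤ c k)

{-# OPTIONS --safe #-}

-- Let m and M be the least and greatest leaf values and x the value of the
-- centre.  The leaf map is monotone, so the extreme leaves stay extreme.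
-- If x > M, every leaf gains a chip and the centre loses n - 1.  Either the
-- centre is then below every leaf and the next step undoes this one, or
-- m + n ≤ x and the distance from x to [m , M] has dropped by n (or to 0),
-- with M - m unchanged; the case x < m is symmetric.  If m ≤ x ≤ M and m < M,
-- then M - m drops and the centre ends at distance at most n from [m , M],
-- which costs at most one extra step.
module Submission where

open import Defs
open import Data.Bool.Base using (true; false)
open import Data.Fin.Base using (Fin; zero; suc)
import Data.Fin.Properties as Fin
open import Data.Integer.Base using (+_; 0ℤ; _+_; _-_; _*_; _⊔_; _≤_)
open import Data.Integer.Base as ℤ using (ℤ; -_; 1ℤ; _<_; ∣_∣)
import Data.Integer.DivMod as ℤ
import Data.Integer.Properties as ℤ
open import Data.Integer.Tactic.RingSolver using (solve-∀)
open import Data.Nat.Base using (ℕ; NonZero; _≥_)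
open import Data.Nat.Base as ℕ using (z≤n; s≤s)
open import Data.Nat.GeneralisedArithmetic using (fold-+)
import Data.Nat.Properties as ℕ
open import Data.Product.Base using (_×_; ∃-syntax)
open import Data.Product.Base using (_,_; proj₁; proj₂)
open import Data.Rational.Unnormalised.Base using (_/_; ceiling)
open import Data.Sum.Base using (inj₁; inj₂)
open import Data.Vec.Base using (Vec; []; _∷_; allFin; count; map)
open import Data.Vec.Properties using (tabulate-allFin)
open import Function.Base using (_∘_)
open import Function.Bundles using (mk⇔)
open import Relation.Binary.Definitions using (tri<; tri≈; tri>)
open import Relation.Binary.PropositionalEquality
open import Relation.Nullary.Decidable
  using (yes; no; does; does-⇔; dec-false; _×-dec_; ¬?)
open import Relation.Nullary.Negation using (¬_; contradiction)
open import Relation.Unary using (Pred; Decidable)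

-- Counting in vectors and in `allFin`

module _ {a p} {A : Set a} {P : Pred A p} (P? : Decidable P) where

  count-none : (∀ x → ¬ P x) → ∀ {n} (xs : Vec A n) → count P? xs ≡ 0
  count-none ¬P []       = refl
  count-none ¬P (x ∷ xs)
    rewrite dec-false (P? x) (¬P x) = count-none ¬P xs

  count-complement : ∀ {n} (xs : Vec A n) →
                     count P? xs ℕ.+ count (¬? ∘ P?) xs ≡ n
  count-complement []       = refl
  count-complement (x ∷ xs) with does (P? x)
  ... | true  = cong ℕ.suc (count-complement xs)
  ... | false = trans (ℕ.+-suc _ _) (cong ℕ.suc (count-complement xs))

  count-map : ∀ {b} {B : Set b} (f : B → A) {n} (xs : Vec B n) →
              count P? (map f xs) ≡ count (P? ∘ f) xs
  count-map f []       = refl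
  count-map f (x ∷ xs) with does (P? (f x))
  ... | true  = cong ℕ.suc (count-map f xs)
  ... | false = count-map f xs

module _ {a p q} {A : Set a} {P : Pred A p} {Q : Pred A q}
         (P? : Decidable P) (Q? : Decidable Q) where

  count-cong : (∀ {x} → P x → Q x) → (∀ {x} → Q x → P x) →
               ∀ {n} (xs : Vec A n) → count P? xs ≡ count Q? xs
  count-cong P⊆Q Q⊆P []       = refl
  count-cong P⊆Q Q⊆P (x ∷ xs)
    rewrite does-⇔ (mk⇔ P⊆Q Q⊆P) (P? x) (Q? x)
          | count-cong P⊆Q Q⊆P xs = refl

  count-mono-⊆ : (∀ {x} → P x → Q x) →
                 ∀ {n} (xs : Vec A n) → count P? xs ℕ.≤ count Q? xs
  count-mono-⊆ P⊆Q []       = z≤n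
  count-mono-⊆ P⊆Q (x ∷ xs) with P? x | Q? x
  ... | yes _ | yes _ = s≤s (count-mono-⊆ P⊆Q xs)
  ... | yes p | no ¬q = contradiction (P⊆Q p) ¬q
  ... | no  _ | yes _ = ℕ.m≤n⇒m≤1+n (count-mono-⊆ P⊆Q xs)
  ... | no  _ | no  _ = count-mono-⊆ P⊆Q xs

count-≡ : ∀ {n} (i : Fin n) → count (Fin._≟ i) (allFin n) ≡ 1
count-≡ {ℕ.suc n} zero
  -- The tail of `allFin (ℕ.suc n)` is `tabulate suc`; read as `map suc (allFin n)`, it becomes a
  -- count over `allFin n`.
  rewrite tabulate-allFin {n = n} suc
        | count-map (Fin._≟ zero) suc (allFin n)
  = cong ℕ.suc (count-none (λ j → suc j Fin.≟ zero) (λ _ ()) (allFin n))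
count-≡ {ℕ.suc n} (suc i)
  rewrite tabulate-allFin {n = n} suc
        | count-map (Fin._≟ suc i) suc (allFin n)
  = trans (count-cong (λ j → suc j Fin.≟ suc i) (Fin._≟ i)
             Fin.suc-injective (cong suc) (allFin n))
          (count-≡ i)

-- The successor on the left gives the degree n - 1 of the centre without truncated subtraction; the
-- integer identities further on absorb the extra 1.
count-≢ : ∀ {n} (i : Fin n) →
          ℕ.suc (count (λ j → ¬? (j Fin.≟ i)) (allFin n)) ≡ n
count-≢ {n} i =
  subst (λ k → k ℕ.+ count (λ j → ¬? (j Fin.≟ i)) (allFin n) ≡ n)
        (count-≡ i) (count-complement (Fin._≟ i) (allFin n))

-- Least witnesses, iterates and pre-periods

least : ∀ {P : ℕ → Set} → Decidable P → ∀ t → P t → ∃[ m ] Least P m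
least P? t pt with P? 0
... | yes p₀ = 0 , p₀ , λ _ _ → z≤n
least     P? ℕ.zero    pt | no ¬p₀ = contradiction pt ¬p₀
least {P} P? (ℕ.suc t) pt | no ¬p₀ with least (P? ∘ ℕ.suc) t pt
... | m , pm , m-least = ℕ.suc m , pm , m+1-least
  where
  m+1-least : ∀ k → P k → ℕ.suc m ℕ.≤ k
  m+1-least ℕ.zero    p₀ = contradiction p₀ ¬p₀
  m+1-least (ℕ.suc k) pk = s≤s (m-least k pk)

module _ {n : ℕ} (G : SimpleGraph n) where
  open SimpleGraph G

  -- Pointwise equality is not substitutive, so it has to be carried through each step explicitly.
  step-cong : ∀ {c c′ : Config n} → c ≗ c′ → step G c ≗ step G c′
  step-cong {c} {c′} c≗c′ u =
    cong₂ (λ x y → x + + y)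
      (cong₂ (λ x y → x - + y) (c≗c′ u) (count-cong
        (λ w → adj? u w ×-dec (c w ℤ.<? c u))
        (λ w → adj? u w ×-dec (c′ w ℤ.<? c′ u))
        (λ {w} (a , w<u) → a , subst₂ _<_ (c≗c′ w) (c≗c′ u) w<u)
        (λ {w} (a , w<u) →
          a , subst₂ _<_ (sym (c≗c′ w)) (sym (c≗c′ u)) w<u)
        (allFin n)))
      (count-cong
        (λ w → adj? u w ×-dec (c u ℤ.<? c w))
        (λ w → adj? u w ×-dec (c′ u ℤ.<? c′ w))
        (λ {w} (a , u<w) → a , subst₂ _<_ (c≗c′ u) (c≗c′ w) u<w)
        (λ {w} (a , u<w) →
          a , subst₂ _<_ (sym (c≗c′ u)) (sym (c≗c′ w)) u<w)
        (allFin n))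

  run-+ : ∀ (c : Config n) s t → run G c (s ℕ.+ t) ≡ run G (run G c t) s
  run-+ c s t = fold-+ c (step G) s

  run-step : ∀ (c : Config n) t → run G (step G c) t ≡ run G c (ℕ.suc t)
  run-step c t = trans (sym (run-+ c t 1)) (cong (run G c) (ℕ.+-comm t 1))

  module _ (c : Config n) where

    private
      c[_] : ℕ → Config n
      c[ t ] = run G c t

    -- The even shift `s + s` reaches past any given time `s`, and each induction step adds exactly
    -- one period.
    period-2-recurs : ∀ {t} → c[ 2 ℕ.+ t ] ≗ c[ t ] →
                      ∀ s → c[ s ℕ.+ s ℕ.+ t ] ≗ c[ t ]
    period-2-recurs     eq ℕ.zero    u = refl
    period-2-recurs {t} eq (ℕ.suc s) u
      rewrite ℕ.+-suc s s =
      trans (step-cong (step-cong (period-2-recurs eq s)) u) (eq u)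

    fixed-persists : ∀ {s} → c[ 1 ℕ.+ s ] ≗ c[ s ] →
                     ∀ k → c[ 1 ℕ.+ (k ℕ.+ s) ] ≗ c[ k ℕ.+ s ]
    fixed-persists eq ℕ.zero    = eq
    fixed-persists eq (ℕ.suc k) = step-cong (fixed-persists eq k)

    -- The configuration at `t` recurs at a time after `s`, when the process is already fixed; so it
    -- is itself the fixed configuration.
    period-2-fixed : ∀ {s t} → c[ 2 ℕ.+ t ] ≗ c[ t ] →
                     c[ 1 ℕ.+ s ] ≗ c[ s ] → c[ 1 ℕ.+ t ] ≗ c[ t ]
    period-2-fixed {s} {t} eq₂ eq₁ u = begin
      c[ 1 ℕ.+ t ] u               ≡⟨ step-cong recurs u ⟨
      c[ 1 ℕ.+ (s ℕ.+ s ℕ.+ t) ] u ≡⟨ cong (λ k → c[ 1 ℕ.+ k ] u) late ⟩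
      c[ 1 ℕ.+ (s ℕ.+ t ℕ.+ s) ] u ≡⟨ fixed-persists eq₁ (s ℕ.+ t) u ⟩
      c[ s ℕ.+ t ℕ.+ s ] u         ≡⟨ cong (λ k → c[ k ] u) late ⟨
      c[ s ℕ.+ s ℕ.+ t ] u         ≡⟨ recurs u ⟩
      c[ t ] u                     ∎
      where
      open ≡-Reasoning
      recurs = period-2-recurs eq₂ s
      late : s ℕ.+ s ℕ.+ t ≡ s ℕ.+ t ℕ.+ s
      late = trans (ℕ.+-assoc s s t)
               (trans (cong (s ℕ.+_) (ℕ.+-comm s t)) (sym (ℕ.+-assoc s t s)))

    returns? : ∀ p → Decidable (λ s → c[ p ℕ.+ s ] ≗ c[ s ])
    returns? p s = Fin.all? (λ u → c[ p ℕ.+ s ] u ℤ.≟ c[ s ] u)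

    -- Whether the minimal period is 1 or 2 can be decided at `t` alone: by `period-2-fixed`, a
    -- fixed configuration at any time forces one at `t`. Either way `t` is a return time for the
    -- minimal period and so bounds the least one.
    prePeriodLength-bound : ∀ {t} → c[ 2 ℕ.+ t ] ≗ c[ t ] →
                            ∃[ m ] PrePeriodLength G c m × m ℕ.≤ t
    prePeriodLength-bound {t} eq with returns? 1 t
    ... | yes fixed =
      let m , m-least = least (returns? 1) t fixed
      -- That no period is smaller than 1 is the first component of `EventualPeriod`.
      in m , (1 , ((s≤s z≤n , t , fixed) , λ _ → proj₁) , m-least)
           , proj₂ m-least t fixed
    ... | no ¬fixed =
      let m , m-least = least (returns? 2) t eq
      in m , (2 , ((s≤s z≤n , t , eq) , 2-least) , m-least)
           , proj₂ m-least t eq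
      where
      2-least : ∀ p → EventualPeriod G c p → 2 ℕ.≤ p
      2-least 1 (_ , s , fixed) = contradiction (period-2-fixed {s} {t} eq fixed) ¬fixed
      2-least (ℕ.suc (ℕ.suc p)) _ = s≤s (s≤s z≤n)

-- Turns a linear inequality into a known one plus a ring identity between differences, which
-- `solve-∀` can prove.
≤-from-difference : ∀ {i j k l} → i ≤ j → j - i ≡ l - k → k ≤ l
≤-from-difference i≤j eq = ℤ.0≤i-j⇒j≤i (subst (0ℤ ≤_) eq (ℤ.i≤j⇒0≤j-i i≤j))

-- Neighbour counts in a star

module _ {n : ℕ} (v : Fin n) where
  open SimpleGraph (star v)

  module _ {p} {P : Pred (Fin n) p} (P? : Decidable P) where

    neighbours : Fin n → ℕ
    neighbours u = count (λ w → adj? u w ×-dec P? w) (allFin n)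

    neighbours-none : ∀ {u} → (∀ w → Adj u w → ¬ P w) → neighbours u ≡ 0
    neighbours-none ¬P =
      count-none (λ w → adj? _ w ×-dec P? w) (λ w (a , pw) → ¬P w a pw) (allFin n)

    -- A leaf has the centre as its only neighbour, so the count is that of the single vertex `v`.
    leaf-neighbours : ∀ {u} → u ≢ v → P v → neighbours u ≡ 1
    leaf-neighbours {u} u≢v pv =
      trans (count-cong (λ w → adj? u w ×-dec P? w) (Fin._≟ v)
               (λ { (inj₁ (u≡v , _) , _) → contradiction u≡v u≢v
                  ; (inj₂ (w≡v , _) , _) → w≡v })
               (λ { refl → inj₂ (refl , u≢v) , pv })
               (allFin n))
            (count-≡ v)

    centre-neighbours : (∀ w → w ≢ v → P w) → ℕ.suc (neighbours v) ≡ n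
    centre-neighbours p =
      trans (cong ℕ.suc
               (count-cong (λ w → adj? v w ×-dec P? w) (λ w → ¬? (w Fin.≟ v))
                  (λ { (inj₁ (_ , w≢v) , _) → w≢v
                     ; (inj₂ (_ , v≢v) , _) → contradiction refl v≢v })
                  (λ w≢v → inj₁ (refl , w≢v) , p _ w≢v)
                  (allFin n)))
            (count-≢ v)

    centre-neighbours-≤ : ℕ.suc (neighbours v) ℕ.≤ n
    centre-neighbours-≤ =
      subst (ℕ.suc (neighbours v) ℕ.≤_) (count-≢ v)
        (s≤s (count-mono-⊆ (λ w → adj? v w ×-dec P? w) (λ w → ¬? (w Fin.≟ v))
                (λ { (inj₁ (_ , w≢v) , _) → w≢v
                   ; (inj₂ (_ , v≢v) , _) → contradiction refl v≢v })
                (allFin n)))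

  leaf-adj : ∀ {u w} → u ≢ v → Adj u w → w ≡ v
  leaf-adj u≢v (inj₁ (u≡v , _)) = contradiction u≡v u≢v
  leaf-adj u≢v (inj₂ (w≡v , _)) = w≡v

  centre-adj : ∀ {w} → Adj v w → w ≢ v
  centre-adj (inj₁ (_ , w≢v)) = w≢v
  centre-adj (inj₂ (_ , v≢v)) = contradiction refl v≢v

  -- One step of diffusion on a star

  module _ (c : Config n) where

    private
      c′ : Config n
      c′ = step (star v) c

    step-by : ∀ {u p r} → poorerNeighbours (star v) c u ≡ p →
              richerNeighbours (star v) c u ≡ r → c′ u ≡ c u - + p + + r
    step-by {u} = cong₂ (λ p r → c u - + p + + r)

    leaf-below : ∀ {u} → u ≢ v → c u < c v → c′ u ≡ ℤ.suc (c u)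
    leaf-below {u} u≢v u<v = trans
      (step-by
        (neighbours-none (λ w → c w ℤ.<? c u)
          (λ w a w<u → ℤ.<-asym u<v (subst (λ w → c w < c u) (leaf-adj u≢v a) w<u)))
        (leaf-neighbours (λ w → c u ℤ.<? c w) u≢v u<v))
      (identity (c u))
      where
      identity : ∀ x → x - 0ℤ + 1ℤ ≡ 1ℤ + x
      identity = solve-∀

    leaf-above : ∀ {u} → u ≢ v → c v < c u → c′ u ≡ ℤ.pred (c u)
    leaf-above {u} u≢v v<u = trans
      (step-by
        (leaf-neighbours (λ w → c w ℤ.<? c u) u≢v v<u)
        (neighbours-none (λ w → c u ℤ.<? c w)
          (λ w a u<w → ℤ.<-asym v<u (subst (λ w → c u < c w) (leaf-adj u≢v a) u<w))))
      (identity (c u))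
      where
      identity : ∀ x → x - 1ℤ + 0ℤ ≡ - 1ℤ + x
      identity = solve-∀

    leaf-level : ∀ {u} → u ≢ v → c u ≡ c v → c′ u ≡ c u
    leaf-level {u} u≢v u≡v = trans
      (step-by
        (neighbours-none (λ w → c w ℤ.<? c u)
          (λ w a w<u → ℤ.<-irrefl (trans (cong c (leaf-adj u≢v a)) (sym u≡v)) w<u))
        (neighbours-none (λ w → c u ℤ.<? c w)
          (λ w a u<w → ℤ.<-irrefl (trans u≡v (sym (cong c (leaf-adj u≢v a)))) u<w)))
      (identity (c u))
      where
      identity : ∀ x → x - 0ℤ + 0ℤ ≡ x
      identity = solve-∀

    centre-above : (∀ w → w ≢ v → c w < c v) → c′ v ≡ ℤ.suc (c v) - + n
    centre-above leaves<v = trans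
      (step-by refl
        (neighbours-none (λ w → c v ℤ.<? c w)
          (λ w a → ℤ.<-asym (leaves<v w (centre-adj a)))))
      (trans (identity (c v) (+ neighbours (λ w → c w ℤ.<? c v) v))
             (cong (λ k → ℤ.suc (c v) - + k)
                   (centre-neighbours (λ w → c w ℤ.<? c v) leaves<v)))
      where
      identity : ∀ x p → x - p + 0ℤ ≡ 1ℤ + x - (1ℤ + p)
      identity = solve-∀

    centre-below : (∀ w → w ≢ v → c v < c w) → c′ v ≡ ℤ.pred (c v) + + n
    centre-below v<leaves = trans
      (step-by
        (neighbours-none (λ w → c w ℤ.<? c v)
          (λ w a → ℤ.<-asym (v<leaves w (centre-adj a))))
        refl)
      (trans (identity (c v) (+ neighbours (λ w → c v ℤ.<? c w) v))
             (cong (λ k → ℤ.pred (c v) + + k)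
                   (centre-neighbours (λ w → c v ℤ.<? c w) v<leaves)))
      where
      identity : ∀ x r → x - 0ℤ + r ≡ - 1ℤ + x + (1ℤ + r)
      identity = solve-∀

    centre-level : (∀ w → w ≢ v → c w ≡ c v) → c′ v ≡ c v
    centre-level leaves≡v = trans
      (step-by
        (neighbours-none (λ w → c w ℤ.<? c v)
          (λ w a → ℤ.<-irrefl (leaves≡v w (centre-adj a))))
        (neighbours-none (λ w → c v ℤ.<? c w)
          (λ w a → ℤ.<-irrefl (sym (leaves≡v w (centre-adj a))))))
      (identity (c v))
      where
      identity : ∀ x → x - 0ℤ + 0ℤ ≡ x
      identity = solve-∀

    -- The coarse n in place of n - 1 matches the unit in which `Centred` measures distance.
    centre-step-≤ : c′ v ≤ c v + + n
    centre-step-≤ = ℤ.+-mono-≤ (ℤ.i-j≤i (c v) (+ poorerNeighbours (star v) c v))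
      (ℤ.+≤+ (ℕ.<⇒≤ (centre-neighbours-≤ (λ w → c v ℤ.<? c w))))

    centre-step-≥ : c v - + n ≤ c′ v
    centre-step-≥ = ℤ.≤-trans
      (ℤ.+-monoʳ-≤ (c v) (ℤ.neg-mono-≤
        (ℤ.+≤+ (ℕ.<⇒≤ (centre-neighbours-≤ (λ w → c w ℤ.<? c v))))))
      (ℤ.i≤i+j _ (+ richerNeighbours (star v) c v))

    -- A leaf moves by at most one chip, and values are integers, so it cannot overshoot the old
    -- value of the centre.
    leaf-rises : ∀ {u} → u ≢ v → c u ≤ c v → c u ≤ c′ u × c′ u ≤ c v
    leaf-rises {u} u≢v u≤v with ℤ.<-cmp (c u) (c v)
    ... | tri< u<v _ _ rewrite leaf-below u≢v u<v =
      ℤ.i≤suc[i] (c u) , ℤ.i<j⇒suc[i]≤j u<v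
    ... | tri≈ _ u≡v _ rewrite leaf-level u≢v u≡v = ℤ.≤-refl , u≤v
    ... | tri> _ _ v<u = contradiction u≤v (ℤ.<⇒≱ v<u)

    leaf-falls : ∀ {u} → u ≢ v → c v ≤ c u → c v ≤ c′ u × c′ u ≤ c u
    leaf-falls {u} u≢v v≤u with ℤ.<-cmp (c u) (c v)
    ... | tri> _ _ v<u rewrite leaf-above u≢v v<u =
      ℤ.i<j⇒i≤pred[j] v<u , ℤ.i≤j⇒pred[i]≤j ℤ.≤-refl
    ... | tri≈ _ u≡v _ rewrite leaf-level u≢v u≡v = v≤u , ℤ.≤-refl
    ... | tri< u<v _ _ = contradiction v≤u (ℤ.<⇒≱ u<v)

    -- Two leaves strictly on the same side of the centre move by the same chip. Otherwise the old
    -- value of the centre separates the two new leaf values.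
    leaf-step-mono : ∀ {k l} → k ≢ v → l ≢ v → c k ≤ c l → c′ k ≤ c′ l
    leaf-step-mono {k} {l} k≢v l≢v k≤l with c l ℤ.<? c v
    ... | yes l<v
      rewrite leaf-below l≢v l<v | leaf-below k≢v (ℤ.≤-<-trans k≤l l<v) =
      ℤ.suc-mono k≤l
    ... | no l≮v with c v ℤ.<? c k
    ... | yes v<k
      rewrite leaf-above k≢v v<k | leaf-above l≢v (ℤ.<-≤-trans v<k k≤l) =
      ℤ.pred-mono k≤l
    ... | no v≮k =
      ℤ.≤-trans (proj₂ (leaf-rises k≢v (ℤ.≮⇒≥ v≮k)))
                (proj₁ (leaf-falls l≢v (ℤ.≮⇒≥ l≮v)))

    maximumLeaf-step : ∀ {ℓ} → IsMaximumLeaf v c ℓ → IsMaximumLeaf v c′ ℓ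
    maximumLeaf-step (ℓ≢v , max) =
      ℓ≢v , λ k k≢v → leaf-step-mono k≢v ℓ≢v (max k k≢v)

    minimumLeaf-step : ∀ {ℓ} → IsMinimumLeaf v c ℓ → IsMinimumLeaf v c′ ℓ
    minimumLeaf-step (ℓ≢v , min) =
      ℓ≢v , λ k k≢v → leaf-step-mono ℓ≢v k≢v (min k k≢v)

  centre-or-leaf : ∀ {f g : Config n} →
                   f v ≡ g v → (∀ u → u ≢ v → f u ≡ g u) → f ≗ g
  centre-or-leaf centre leaf u with u Fin.≟ v
  ... | yes refl = centre
  ... | no u≢v   = leaf u u≢v

  -- `K` is the budget of steps the centre may spend outside the range of the leaves, each worth one
  -- multiple of `n`. The multiplicative form keeps division and ceilings out of the induction.
  Centred : ℕ → Config n → Fin n → Fin n → Set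
  Centred K c ℓM ℓm = c v ≤ c ℓM + + K * + n × c ℓm ≤ c v + + K * + n

  module _ {c : Config n} {ℓM ℓm : Fin n}
           (ℓM-max : IsMaximumLeaf v c ℓM) (ℓm-min : IsMinimumLeaf v c ℓm) where

    private
      c′ : Config n
      c′ = step (star v) c

      ℓM≢v : ℓM ≢ v
      ℓM≢v = proj₁ ℓM-max

      ℓm≢v : ℓm ≢ v
      ℓm≢v = proj₁ ℓm-min

    -- Centre strictly above every leaf

    module _ (M<v : c ℓM < c v) where

      leaves<centre : ∀ w → w ≢ v → c w < c v
      leaves<centre w w≢v = ℤ.≤-<-trans (proj₂ ℓM-max w w≢v) M<v

      leaves-rise : ∀ w → w ≢ v → c′ w ≡ ℤ.suc (c w)
      leaves-rise w w≢v = leaf-below c w≢v (leaves<centre w w≢v)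

      v-drops : c′ v ≡ ℤ.suc (c v) - + n
      v-drops = centre-above c leaves<centre

      -- The centre drops by n - 1 while each leaf gains 1, so the hypothesis is what puts the
      -- centre strictly below every leaf. The next step then returns n - 1 chips to it.
      above-alternates : c v < c ℓm + + n → step (star v) c′ ≗ c
      above-alternates v<m+n = centre-or-leaf centre leaf
        where
        centre<leaves : ∀ w → w ≢ v → c′ v < c′ w
        centre<leaves w w≢v = subst₂ _<_ (sym v-drops) (sym (leaves-rise w w≢v))
          (ℤ.suc[i]≤j⇒i<j (≤-from-difference
            (ℤ.i<j⇒suc[i]≤j (ℤ.<-≤-trans v<m+n
              (ℤ.+-monoˡ-≤ (+ n) (proj₂ ℓm-min w w≢v))))
            (identity (c v) (c w) (+ n))))
          where
          identity : ∀ x y k →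
                     y + k - (1ℤ + x) ≡ 1ℤ + y - (1ℤ + (1ℤ + x - k))
          identity = solve-∀
        open ≡-Reasoning
        identity : ∀ x k → - 1ℤ + (1ℤ + x - k) + k ≡ x
        identity = solve-∀
        centre : step (star v) c′ v ≡ c v
        centre = begin
          step (star v) c′ v               ≡⟨ centre-below c′ centre<leaves ⟩
          ℤ.pred (c′ v) + + n              ≡⟨ cong (λ x → ℤ.pred x + + n) v-drops ⟩
          ℤ.pred (ℤ.suc (c v) - + n) + + n ≡⟨ identity (c v) (+ n) ⟩
          c v                              ∎
        leaf : ∀ u → u ≢ v → step (star v) c′ u ≡ c u
        leaf u u≢v = begin
          step (star v) c′ u   ≡⟨ leaf-above c′ u≢v (centre<leaves u u≢v) ⟩
          ℤ.pred (c′ u)        ≡⟨ cong ℤ.pred (leaves-rise u u≢v) ⟩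
          ℤ.pred (ℤ.suc (c u)) ≡⟨ ℤ.pred-suc (c u) ⟩
          c u                  ∎

      -- Relative to the leaves the centre falls by exactly n, which pays for one unit of `K`. The
      -- hypothesis keeps it from falling past the least leaf, so the other half holds even with
      -- budget 0.
      above-centred : ∀ K → c ℓm + + n ≤ c v →
                      Centred (ℕ.suc K) c ℓM ℓm → Centred K c′ ℓM ℓm
      above-centred K m+n≤v (v≤M , _)
        rewrite v-drops | leaves-rise ℓM ℓM≢v | leaves-rise ℓm ℓm≢v =
          ≤-from-difference v≤M (identity₁ (c v) (c ℓM) (+ K) (+ n))
        , ≤-from-difference
            -- The multiple of `n` is padding here, written as a cast natural so that it is visibly
            -- nonnegative.
            (ℤ.≤-trans m+n≤v (ℤ.i≤i+j (c v) (+ (K ℕ.* n))))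
            (trans (cong (λ k → c v + k - (c ℓm + + n)) (ℤ.pos-* K n))
                   (identity₂ (c v) (c ℓm) (+ K) (+ n)))
        where
        identity₁ : ∀ x M K k → M + (1ℤ + K) * k - x ≡
                                1ℤ + M + K * k - (1ℤ + x - k)
        identity₁ = solve-∀
        identity₂ : ∀ x m K k → x + K * k - (m + k) ≡
                                1ℤ + x - k + K * k - (1ℤ + m)
        identity₂ = solve-∀

      above-spread : ∀ {d} → c ℓM ≤ c ℓm + d → c′ ℓM ≤ c′ ℓm + d
      above-spread {d} M≤m+d
        rewrite leaves-rise ℓM ℓM≢v | leaves-rise ℓm ℓm≢v =
        ≤-from-difference M≤m+d (identity (c ℓM) (c ℓm) d)
        where
        identity : ∀ M m d → m + d - M ≡ 1ℤ + m + d - (1ℤ + M)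
        identity = solve-∀

    -- Centre strictly below every leaf

    module _ (v<m : c v < c ℓm) where

      centre<leaves : ∀ w → w ≢ v → c v < c w
      centre<leaves w w≢v = ℤ.<-≤-trans v<m (proj₂ ℓm-min w w≢v)

      leaves-fall : ∀ w → w ≢ v → c′ w ≡ ℤ.pred (c w)
      leaves-fall w w≢v = leaf-above c w≢v (centre<leaves w w≢v)

      v-climbs : c′ v ≡ ℤ.pred (c v) + + n
      v-climbs = centre-below c centre<leaves

      below-alternates : c ℓM < c v + + n → step (star v) c′ ≗ c
      below-alternates M<v+n = centre-or-leaf centre leaf
        where
        leaves<centre′ : ∀ w → w ≢ v → c′ w < c′ v
        leaves<centre′ w w≢v = subst₂ _<_ (sym (leaves-fall w w≢v)) (sym v-climbs)
          (ℤ.suc[i]≤j⇒i<j (≤-from-difference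
            (ℤ.i<j⇒suc[i]≤j (ℤ.≤-<-trans (proj₂ ℓM-max w w≢v) M<v+n))
            (identity (c v) (c w) (+ n))))
          where
          identity : ∀ x y k →
                     x + k - (1ℤ + y) ≡ - 1ℤ + x + k - (1ℤ + (- 1ℤ + y))
          identity = solve-∀
        open ≡-Reasoning
        identity : ∀ x k → 1ℤ + (- 1ℤ + x + k) - k ≡ x
        identity = solve-∀
        centre : step (star v) c′ v ≡ c v
        centre = begin
          step (star v) c′ v                ≡⟨ centre-above c′ leaves<centre′ ⟩
          ℤ.suc (c′ v) - + n                ≡⟨ cong (λ x → ℤ.suc x - + n) v-climbs ⟩
          ℤ.suc (ℤ.pred (c v) + + n) - + n  ≡⟨ identity (c v) (+ n) ⟩
          c v                               ∎
        leaf : ∀ u → u ≢ v → step (star v) c′ u ≡ c u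
        leaf u u≢v = begin
          step (star v) c′ u   ≡⟨ leaf-below c′ u≢v (leaves<centre′ u u≢v) ⟩
          ℤ.suc (c′ u)         ≡⟨ cong ℤ.suc (leaves-fall u u≢v) ⟩
          ℤ.suc (ℤ.pred (c u)) ≡⟨ ℤ.suc-pred (c u) ⟩
          c u                  ∎

      -- Now the half about `ℓm` shrinks by n, and the hypothesis keeps the centre from rising past
      -- the greatest leaf.
      below-centred : ∀ K → c v + + n ≤ c ℓM →
                      Centred (ℕ.suc K) c ℓM ℓm → Centred K c′ ℓM ℓm
      below-centred K v+n≤M (_ , m≤v)
        rewrite v-climbs | leaves-fall ℓM ℓM≢v | leaves-fall ℓm ℓm≢v =
          ≤-from-difference
            (ℤ.≤-trans v+n≤M (ℤ.i≤i+j (c ℓM) (+ (K ℕ.* n))))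
            (trans (cong (λ k → c ℓM + k - (c v + + n)) (ℤ.pos-* K n))
                   (identity₁ (c v) (c ℓM) (+ K) (+ n)))
        , ≤-from-difference m≤v (identity₂ (c v) (c ℓm) (+ K) (+ n))
        where
        identity₁ : ∀ x M K k → M + K * k - (x + k) ≡
                                - 1ℤ + M + K * k - (- 1ℤ + x + k)
        identity₁ = solve-∀
        identity₂ : ∀ x m K k → x + (1ℤ + K) * k - m ≡
                                - 1ℤ + x + k + K * k - (- 1ℤ + m)
        identity₂ = solve-∀

      below-spread : ∀ {d} → c ℓM ≤ c ℓm + d → c′ ℓM ≤ c′ ℓm + d
      below-spread {d} M≤m+d
        rewrite leaves-fall ℓM ℓM≢v | leaves-fall ℓm ℓm≢v =
        ≤-from-difference M≤m+d (identity (c ℓM) (c ℓm) d)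
        where
        identity : ∀ M m d → m + d - M ≡ - 1ℤ + m + d - (- 1ℤ + M)
        identity = solve-∀

    -- Centre between the extreme leaves

    module _ (m≤v : c ℓm ≤ c v) (v≤M : c v ≤ c ℓM) where

      -- The old value of the centre still lies between the new extreme leaves, and the centre moves
      -- at most n away from it.
      between-centred : Centred 1 c′ ℓM ℓm
      between-centred rewrite ℤ.*-identityˡ (+ n) =
          ℤ.≤-trans (centre-step-≤ c)
            (ℤ.+-monoˡ-≤ (+ n) (proj₁ (leaf-falls c ℓM≢v v≤M)))
        , ℤ.≤-trans (proj₂ (leaf-rises c ℓm≢v m≤v))
            (≤-from-difference (centre-step-≥ c) (identity (c v) (c′ v) (+ n)))
        where
        identity : ∀ x x′ k → x′ - (x - k) ≡ x′ + k - x
        identity = solve-∀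

      -- Neither extreme leaf moves outward. If the centre is below the greatest leaf, that leaf
      -- falls; if not, it is above the least leaf, which rises.
      between-spread : ∀ {d} → c ℓm < c ℓM →
                       c ℓM ≤ c ℓm + ℤ.suc d → c′ ℓM ≤ c′ ℓm + d
      between-spread {d} m<M M≤m+1+d with c v ℤ.<? c ℓM
      ... | yes v<M rewrite leaf-above c ℓM≢v v<M = ℤ.≤-trans
        (≤-from-difference M≤m+1+d (identity (c ℓM) (c ℓm) d))
        (ℤ.+-monoˡ-≤ d (proj₁ (leaf-rises c ℓm≢v m≤v)))
        where
        identity : ∀ M m d → m + (1ℤ + d) - M ≡ m + d - (- 1ℤ + M)
        identity = solve-∀
      ... | no v≮M
        rewrite leaf-below c ℓm≢v (ℤ.<-≤-trans m<M (ℤ.≮⇒≥ v≮M)) =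
        ℤ.≤-trans (proj₂ (leaf-falls c ℓM≢v v≤M))
          (≤-from-difference M≤m+1+d (identity (c ℓM) (c ℓm) d))
        where
        identity : ∀ M m d → m + (1ℤ + d) - M ≡ 1ℤ + m + d - M
        identity = solve-∀

      between-fixed : c ℓM ≤ c ℓm → c′ ≗ c
      between-fixed M≤m =
        centre-or-leaf (centre-level c level) (λ u u≢v → leaf-level c u≢v (level u u≢v))
        where
        level : ∀ w → w ≢ v → c w ≡ c v
        level w w≢v = ℤ.≤-antisym
          (ℤ.≤-trans (proj₂ ℓM-max w w≢v) (ℤ.≤-trans M≤m m≤v))
          (ℤ.≤-trans v≤M (ℤ.≤-trans M≤m (proj₂ ℓm-min w w≢v)))

  -- Settling time by induction

  record SettlesWithin (c : Config n) (b : ℕ) : Set where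
    constructor settled
    field
      time     : ℕ
      time≤b   : time ℕ.≤ b
      periodic : run (star v) c (2 ℕ.+ time) ≗ run (star v) c time

  -- The free bound `b′` serves both kinds of step: it is met exactly when `K` drops, and may leave
  -- slack when `d` drops.
  settles-after-step : ∀ {c b b′} → ℕ.suc b ℕ.≤ b′ →
                       SettlesWithin (step (star v) c) b → SettlesWithin c b′
  settles-after-step {c} b<b′ (settled t t≤b eq) =
    settled (ℕ.suc t) (ℕ.≤-trans (s≤s t≤b) b<b′)
      (subst₂ _≗_ (run-step (star v) c (2 ℕ.+ t)) (run-step (star v) c t) eq)

  -- The induction is lexicographic in (d , K): K may grow when d drops.
  settles : ∀ K d {c ℓM ℓm} → IsMaximumLeaf v c ℓM → IsMinimumLeaf v c ℓm →
            c ℓM ≤ c ℓm + + d → Centred K c ℓM ℓm →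
            SettlesWithin c (K ℕ.+ 2 ℕ.* d)
  settles K d {c} {ℓM} {ℓm} max min spread centred
    with c ℓM ℤ.<? c v | c v ℤ.<? c ℓm | c ℓm ℤ.<? c ℓM
  settles ℕ.zero d {c} {ℓM} max min spread (v≤M , _) | yes M<v | _ | _ =
    contradiction (subst (c v ≤_) (ℤ.+-identityʳ (c ℓM)) v≤M) (ℤ.<⇒≱ M<v)
  settles (ℕ.suc K) d {c} {ℓM} {ℓm} max min spread centred
    | yes M<v | _ | _ with c v ℤ.<? c ℓm + + n
  -- The present configuration already lies on the 2-cycle, so no budget is spent.
  ... | yes v<m+n = settled 0 z≤n (above-alternates max min M<v v<m+n)
  ... | no v≮m+n  = settles-after-step ℕ.≤-refl
    (settles K d (maximumLeaf-step c max) (minimumLeaf-step c min)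
      (above-spread max min M<v spread)
      (above-centred max min M<v K (ℤ.≮⇒≥ v≮m+n) centred))
  settles ℕ.zero d {c} max min spread (_ , m≤v) | no _ | yes v<m | _ =
    contradiction (subst (_ ≤_) (ℤ.+-identityʳ (c v)) m≤v) (ℤ.<⇒≱ v<m)
  settles (ℕ.suc K) d {c} {ℓM} {ℓm} max min spread centred
    | no _ | yes v<m | _ with c ℓM ℤ.<? c v + + n
  ... | yes M<v+n = settled 0 z≤n (below-alternates max min v<m M<v+n)
  ... | no M≮v+n  = settles-after-step ℕ.≤-refl
    (settles K d (maximumLeaf-step c max) (minimumLeaf-step c min)
      (below-spread max min v<m spread)
      (below-centred max min v<m K (ℤ.≮⇒≥ M≮v+n) centred))
  -- A fixed configuration also returns after two steps; `prePeriodLength-bound` later finds its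
  -- true period 1.
  settles K d max min spread centred | no M≮v | no v≮m | no m≮M =
    settled 0 z≤n (λ u → trans (step-cong (star v) fixed u) (fixed u))
    where fixed = between-fixed max min (ℤ.≮⇒≥ v≮m) (ℤ.≮⇒≥ M≮v) (ℤ.≮⇒≥ m≮M)
  settles K ℕ.zero {c} {ℓM} {ℓm} max min spread centred | no _ | no _ | yes m<M =
    contradiction (subst (c ℓM ≤_) (ℤ.+-identityʳ (c ℓm)) spread) (ℤ.<⇒≱ m<M)
  settles K (ℕ.suc d) {c} max min spread centred | no M≮v | no v≮m | yes m<M =
    settles-after-step
      -- The factor 2 comes from here: one unit of `d` pays for this step and for the fresh budget
      -- `K = 1`. The old `K` is discarded.
      (ℕ.≤-trans (ℕ.≤-reflexive (sym (ℕ.*-suc 2 d))) (ℕ.m≤n+m (2 ℕ.* ℕ.suc d) K))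
      (settles 1 d (maximumLeaf-step c max) (minimumLeaf-step c min)
        (between-spread max min m≤v v≤M m<M spread)
        (between-centred max min m≤v v≤M))
    where
    m≤v = ℤ.≮⇒≥ v≮m
    v≤M = ℤ.≮⇒≥ M≮v

-- The ceiling and the final bound

≤-ceiling : ∀ i n .{{_ : NonZero n}} → i ≤ ceiling (i / n) * + n
≤-ceiling i n@(ℕ.suc _) =
  -- `ceiling` is the negated floor of the negation, so this is the floor-division bound at `- i`.
  ≤-from-difference (ℤ.[n/d]*d≤n (- i) (+ n)) (identity i (- i ℤ./ + n) (+ n))
  where
  identity : ∀ i q k → - i - q * k ≡ - q * k - i
  identity = solve-∀

theorem19 : ∀ (n : ℕ) .{{_ : NonZero n}} → n ≥ 2 →
    ∀ (v : Fin n) (c₀ : Config n) (ℓM ℓm : Fin n) →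
    IsMaximumLeaf v c₀ ℓM → IsMinimumLeaf v c₀ ℓm →
    let d₀ = c₀ ℓM - c₀ ℓm in
    Tight (star v) c₀ ×
    ∃[ m ] PrePeriodLength (star v) c₀ m ×
    + m ≤ ceiling ((0ℤ ⊔ (c₀ v - c₀ ℓM) ⊔ (c₀ ℓm - c₀ v)) / n) + + 2 * d₀
theorem19 n@(ℕ.suc _) n≥2 v c₀ ℓM ℓm max min =
  (time , periodic) , m , preperiod , m≤bound
  where
  above below excess q : ℤ
  above  = c₀ v - c₀ ℓM
  below  = c₀ ℓm - c₀ v
  excess = 0ℤ ⊔ above ⊔ below
  q      = ceiling (excess / n)

  excess≤ : excess ≤ q * + n
  excess≤ = ≤-ceiling excess n

  0⊔above≤excess : 0ℤ ⊔ above ≤ excess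
  0⊔above≤excess = ℤ.i≤i⊔j _ below

  -- The induction runs on naturals; both integers are shown nonnegative, so taking absolute values
  -- loses nothing.
  K d : ℕ
  K = ∣ q ∣
  d = ∣ c₀ ℓM - c₀ ℓm ∣

  +K≡q : + K ≡ q
  -- Nonnegativity follows from 0 ≤ `excess` ≤ `q * + n` by cancelling the positive `+ n`.
  +K≡q = ℤ.0≤i⇒+∣i∣≡i (ℤ.*-cancelʳ-≤-pos 0ℤ q (+ n)
    (ℤ.≤-trans (ℤ.≤-trans (ℤ.i≤i⊔j 0ℤ above) 0⊔above≤excess) excess≤))

  +d≡d₀ : + d ≡ c₀ ℓM - c₀ ℓm
  +d≡d₀ = ℤ.0≤i⇒+∣i∣≡i (ℤ.i≤j⇒0≤j-i (proj₂ max ℓm (proj₁ min)))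

  excess≤Kn : excess ≤ + K * + n
  excess≤Kn = subst (λ k → excess ≤ k * + n) (sym +K≡q) excess≤

  bound : ∀ {i} j → i - j ≤ + K * + n → i ≤ j + + K * + n
  bound {i} j i-j≤k = ≤-from-difference i-j≤k (identity i j (+ K * + n))
    where
    identity : ∀ i j k → k - (i - j) ≡ j + k - i
    identity = solve-∀

  spread : c₀ ℓM ≤ c₀ ℓm + + d
  spread rewrite +d≡d₀ = ℤ.≤-reflexive (identity (c₀ ℓM) (c₀ ℓm))
    where
    identity : ∀ M m → M ≡ m + (M - m)
    identity = solve-∀

  open SettlesWithin (settles v K d max min spread
    -- The last two arguments of the maximum supply the two halves of `Centred`.
    ( bound (c₀ ℓM) (ℤ.≤-trans (ℤ.≤-trans (ℤ.i≤j⊔i 0ℤ above) 0⊔above≤excess) excess≤Kn)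
    , bound (c₀ v) (ℤ.≤-trans (ℤ.i≤j⊔i (0ℤ ⊔ above) below) excess≤Kn)))

  bounded = prePeriodLength-bound (star v) c₀ periodic
  m = proj₁ bounded
  preperiod = proj₁ (proj₂ bounded)
  m≤t = proj₂ (proj₂ bounded)

  m≤bound : + m ≤ q + + 2 * (c₀ ℓM - c₀ ℓm)
  m≤bound = begin
    + m                       ≤⟨ ℤ.+≤+ (ℕ.≤-trans m≤t time≤b) ⟩
    + K + + (2 ℕ.* d)         ≡⟨ cong (_+_ (+ K)) (ℤ.pos-* 2 d) ⟩
    + K + + 2 * + d           ≡⟨ cong₂ (λ k e → k + + 2 * e) +K≡q +d≡d₀ ⟩
    q + + 2 * (c₀ ℓM - c₀ ℓm) ∎
    where open ℤ.≤-Reasoning
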